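{- There is an absolute constant $C$ such that every finite Sidon set $\mathcal{A}$ with $k$ elements satisfies \[ \operatorname{diam}(\mathcal{A})\ge k^2-1.96365\,k^{3/2}-Ck. \]
   Context: A Sidon set is a set $\mathcal{A}$ of integers such that the only solutions of $a-b=c-d$ with $a,b,c,d\in\mathcal{A}$ are the trivial ones ($a=b,c=d$ or $a=c,b=d$). For a finite set $\mathcal{A}$, $\operatorname{diam}(\mathcal{A})=\max\mathcal{A}-\min\mathcal{A}$. -}

module Defs where

open import Data.Nat using (ℕ)
open import Data.Integer using (ℤ; +_; _-_; _*_; _⊔_; _⊓_; _≤_; _<_)
open import Data.List using (List; []; _∷_; foldr; length)
open import Data.List.Membership.Propositional using (_∈_)
open import Data.Product using (_×_)
open import Data.Sum using (_⊎_)
open import Relation.Binary.PropositionalEquality using (_≡_)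

Sidon : List ℤ → Set
Sidon A = ∀ {a b c d} → a ∈ A → b ∈ A → c ∈ A → d ∈ A →
          a - b ≡ c - d → (a ≡ b × c ≡ d) ⊎ (a ≡ c × b ≡ d)

maxL : ℤ → List ℤ → ℤ
maxL a as = foldr _⊔_ a as

minL : ℤ → List ℤ → ℤ
minL a as = foldr _⊓_ a as

diam : ℤ → List ℤ → ℤ
diam a as = maxL a as - minL a as

-- The inequality  d ≥ k^2 - 1.96365 k^(3/2) - C k, written without reals:
-- with R = k^2 - C k - d, either R ≤ 0, or R > 0 and
-- (100000 R)^2 ≤ (196365)^2 k^3  (i.e. 100000 R ≤ 196365 k^(3/2)).
DiamBound : ℕ → ℕ → ℤ → Set
DiamBound C k d =
  let K = + k
      R = K * K - (+ C) * K - d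
  in R ≤ + 0 ⊎ ((+ 100000) * R * ((+ 100000) * R) ≤ (+ 196365) * (+ 196365) * (K * K * K))

{-# OPTIONS --safe #-}

-- Weighted version of the Erdős–Turán–Lindström argument.  Let h be 2 on [0,T), 1 on [T,2T), and
-- F(t) = Σ_u h(u) χ(t+u), with χ the indicator of the Sidon set.  For u ≠ v at most one t has both
-- t+u and t+v in the set, so Σ F² ≤ k Σ h² + (Σ h)² = 5Tk + 9T².  On the other side F = 2W + W(· + T)
-- for the plain count W over a window of length T.  Since h is not flat, Σ F² is best tested against
-- weights ρ that oscillate at the left end: ρ = 8, 20, 14, 17 on consecutive blocks of length T and
-- 16 from there on.  They satisfy 2ρ(t+T) + ρ(t) ≥ 48, whence Σ ρF ≥ 48 Σ W = 48Tk, while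
-- Σ ρ² ≤ 256N + 437T for a set in an interval of length N.  Cauchy–Schwarz then gives
-- N ≥ k² − (437/256) T − (5/9) k³/T, and T ≈ (4/7) k^(3/2) makes the loss less than 1.957 k^(3/2) + O(1).

module Submission where

open import Defs
open import Data.Nat
open import Data.Nat.Properties
open import Data.Nat.Tactic.RingSolver using (solve-∀)
open import Data.Integer using (ℤ)
import Data.Integer as ℤ
import Data.Integer.Properties as ℤ
import Algebra.Properties.AbelianGroup ℤ.+-0-abelianGroup as ℤ-Group
import Data.Integer.Tactic.RingSolver as ℤ-RingSolver
open import Data.List using (List; []; _∷_; length; map)
open import Data.List.Properties using (length-map)
open import Data.List.Membership.Propositional using (_∈_)
open import Data.List.Membership.Propositional.Properties using (∈-map⁺)
open import Data.List.Relation.Unary.All as All using (All; []; _∷_)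
import Data.List.Relation.Unary.All.Properties as All
open import Data.List.Relation.Unary.AllPairs as AllPairs using ([]; _∷_)
import Data.List.Relation.Unary.AllPairs.Properties as AllPairs
open import Data.List.Relation.Unary.Any using (here; there)
open import Data.List.Relation.Unary.Unique.Propositional using (Unique)
open import Data.Product as Product using (∃; _×_; _,_)
open import Data.Sum as Sum using (_⊎_; inj₁; inj₂; [_,_]′)
open import Data.Unit using (tt)
open import Function using (_∘_; const)
open import Relation.Nullary using (yes; no; contradiction)
open import Relation.Binary.PropositionalEquality

-- Finite sums over initial segments of the natural numbers.

∑ : ℕ → (ℕ → ℕ) → ℕ
∑ zero    f = 0
∑ (suc n) f = f 0 + ∑ n (f ∘ suc)

∑-mono : ∀ n {f g : ℕ → ℕ} → (∀ t → t < n → f t ≤ g t) → ∑ n f ≤ ∑ n g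
∑-mono zero    f≤g = z≤n
∑-mono (suc n) f≤g = +-mono-≤ (f≤g 0 z<s) (∑-mono n λ t t<n → f≤g (suc t) (s<s t<n))

∑-cong : ∀ n {f g : ℕ → ℕ} → (∀ t → t < n → f t ≡ g t) → ∑ n f ≡ ∑ n g
∑-cong zero    f≡g = refl
∑-cong (suc n) f≡g = cong₂ _+_ (f≡g 0 z<s) (∑-cong n λ t t<n → f≡g (suc t) (s<s t<n))

∑-+ : ∀ n f g → ∑ n (λ t → f t + g t) ≡ ∑ n f + ∑ n g
∑-+ zero    f g = refl
∑-+ (suc n) f g rewrite ∑-+ n (f ∘ suc) (g ∘ suc) = lemma (f 0) (g 0) _ _
  where
  lemma : ∀ a b c d → a + b + (c + d) ≡ a + c + (b + d)
  lemma = solve-∀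

∑-*ˡ : ∀ n c f → ∑ n (λ t → c * f t) ≡ c * ∑ n f
∑-*ˡ zero    c f = sym (*-zeroʳ c)
∑-*ˡ (suc n) c f rewrite ∑-*ˡ n c (f ∘ suc) = sym (*-distribˡ-+ c (f 0) _)

∑-*ʳ : ∀ n c f → ∑ n (λ t → f t * c) ≡ ∑ n f * c
∑-*ʳ n c f = begin
  ∑ n (λ t → f t * c)  ≡⟨ ∑-cong n (λ t _ → *-comm (f t) c) ⟩
  ∑ n (λ t → c * f t)  ≡⟨ ∑-*ˡ n c f ⟩
  c * ∑ n f            ≡⟨ *-comm c _ ⟩
  ∑ n f * c            ∎
  where open ≡-Reasoning

∑-const : ∀ n c → ∑ n (const c) ≡ n * c
∑-const zero    c = refl
∑-const (suc n) c = cong (c +_) (∑-const n c)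

∑-split : ∀ m n f → ∑ (m + n) f ≡ ∑ m f + ∑ n (f ∘ (m +_))
∑-split zero    n f = refl
∑-split (suc m) n f rewrite ∑-split m n (f ∘ suc) = sym (+-assoc (f 0) _ _)

∑-suffix : ∀ m n f → ∑ n (f ∘ (m +_)) ≤ ∑ (m + n) f
∑-suffix m n f = ≤-trans (m≤n+m _ (∑ m f)) (≤-reflexive (sym (∑-split m n f)))

∑-prefix : ∀ m n f → ∑ n f ≤ ∑ (m + n) f
∑-prefix m n f rewrite +-comm m n | ∑-split n m f = m≤m+n _ _

∑-swap : ∀ m n (f : ℕ → ℕ → ℕ) → ∑ m (λ s → ∑ n (f s)) ≡ ∑ n (λ t → ∑ m (λ s → f s t))
∑-swap zero    n f = sym (trans (∑-const n 0) (*-zeroʳ n))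
∑-swap (suc m) n f rewrite ∑-swap m n (f ∘ suc) = sym (∑-+ n (f 0) _)

∑-product : ∀ m n f g → ∑ m f * ∑ n g ≡ ∑ m (λ s → ∑ n (λ t → f s * g t))
∑-product m n f g = begin
  ∑ m f * ∑ n g                        ≡⟨ ∑-*ʳ m _ f ⟨
  ∑ m (λ s → f s * ∑ n g)              ≡⟨ ∑-cong m (λ s _ → ∑-*ˡ n (f s) g) ⟨
  ∑ m (λ s → ∑ n (λ t → f s * g t))    ∎
  where open ≡-Reasoning

-- Cauchy-Schwarz with free multipliers; sums with at most one nonzero term.

2ab≤a²+b² : ∀ a b → 2 * (a * b) ≤ a * a + b * b
2ab≤a²+b² a b =
  [ ordered
  , (λ b≤a → subst₂ _≤_ (cong (2 *_) (*-comm b a)) (+-comm (b * b) (a * a)) (ordered b≤a))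
  ]′ (≤-total a b)
  where
  expand : ∀ a e → 2 * (a * (a + e)) + e * e ≡ a * a + (a + e) * (a + e)
  expand = solve-∀
  ordered : ∀ {a b} → a ≤ b → 2 * (a * b) ≤ a * a + b * b
  ordered {a} {b} a≤b = subst (λ b → 2 * (a * b) ≤ a * a + b * b) (m+[n∸m]≡n a≤b)
    (m+n≤o⇒m≤o _ (≤-reflexive (expand a (b ∸ a))))

-- Cauchy-Schwarz without square roots: AM-GM is applied to `x * f t` and `y * g t`, and little is
-- lost when `x` and `y` make these nearly equal.
∑-amgm : ∀ n x y (f g : ℕ → ℕ) →
         2 * (x * y) * ∑ n (λ t → f t * g t) ≤
         x * x * ∑ n (λ t → f t * f t) + y * y * ∑ n (λ t → g t * g t)
∑-amgm n x y f g = begin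
  2 * (x * y) * ∑ n (λ t → f t * g t)
    ≡⟨ ∑-*ˡ n (2 * (x * y)) (λ t → f t * g t) ⟨
  ∑ n (λ t → 2 * (x * y) * (f t * g t))
    ≤⟨ ∑-mono n (λ t _ → pointwise (f t) (g t)) ⟩
  ∑ n (λ t → x * x * (f t * f t) + y * y * (g t * g t))
    ≡⟨ ∑-+ n (λ t → x * x * (f t * f t)) (λ t → y * y * (g t * g t)) ⟩
  ∑ n (λ t → x * x * (f t * f t)) + ∑ n (λ t → y * y * (g t * g t))
    ≡⟨ cong₂ _+_ (∑-*ˡ n (x * x) (λ t → f t * f t)) (∑-*ˡ n (y * y) (λ t → g t * g t)) ⟩
  x * x * ∑ n (λ t → f t * f t) + y * y * ∑ n (λ t → g t * g t) ∎
  where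
  open ≤-Reasoning
  shuffle : ∀ x y a b → 2 * (x * y) * (a * b) ≡ 2 * (x * a * (y * b))
  shuffle = solve-∀
  squares : ∀ x y a b → x * a * (x * a) + y * b * (y * b) ≡ x * x * (a * a) + y * y * (b * b)
  squares = solve-∀
  pointwise : ∀ a b → 2 * (x * y) * (a * b) ≤ x * x * (a * a) + y * y * (b * b)
  pointwise a b = begin
    2 * (x * y) * (a * b)             ≡⟨ shuffle x y a b ⟩
    2 * (x * a * (y * b))             ≤⟨ 2ab≤a²+b² (x * a) (y * b) ⟩
    x * a * (x * a) + y * b * (y * b) ≡⟨ squares x y a b ⟩
    x * x * (a * a) + y * y * (b * b) ∎

0<m*n⇒0<m : ∀ m {n} → 0 < m * n → 0 < m
0<m*n⇒0<m (suc _) _ = z<s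

0<m*n⇒0<n : ∀ m {n} → 0 < m * n → 0 < n
0<m*n⇒0<n m {n} p = 0<m*n⇒0<m n (subst (0 <_) (*-comm m n) p)

∑-atMostOne : ∀ n (f : ℕ → ℕ) → (∀ t → f t ≤ 1) →
              (∀ s t → 0 < f s → 0 < f t → s ≡ t) → ∑ n f ≤ 1
∑-atMostOne zero    f f≤1 unique = z≤n
∑-atMostOne (suc n) f f≤1 unique with f 0 in eq
... | zero    = ∑-atMostOne n (f ∘ suc) (f≤1 ∘ suc) λ s t p q → suc-injective (unique _ _ p q)
... | suc k = begin
  suc k + ∑ n (f ∘ suc)  ≡⟨ cong₂ _+_ (sym eq) (trans (∑-cong n vanish) (trans (∑-const n 0) (*-zeroʳ n))) ⟩
  f 0 + 0                ≡⟨ +-identityʳ (f 0) ⟩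
  f 0                    ≤⟨ f≤1 0 ⟩
  1                      ∎
  where
  open ≤-Reasoning
  vanish : ∀ t → t < n → f (suc t) ≡ 0
  vanish t _ with f (suc t) in eq′
  ... | zero  = refl
  ... | suc _ = contradiction
    (unique 0 (suc t) (subst (0 <_) (sym eq) z<s) (subst (0 <_) (sym eq′) z<s)) λ ()

-- Kronecker delta and indicator functions of lists.

δ : ℕ → ℕ → ℕ
δ zero    zero    = 1
δ zero    (suc _) = 0
δ (suc _) zero    = 0
δ (suc i) (suc j) = δ i j

δ-refl : ∀ i → δ i i ≡ 1
δ-refl zero    = refl
δ-refl (suc i) = δ-refl i

δ≤1 : ∀ i j → δ i j ≤ 1
δ≤1 zero    zero    = ≤-refl
δ≤1 zero    (suc _) = z≤n
δ≤1 (suc _) zero    = z≤n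
δ≤1 (suc i) (suc j) = δ≤1 i j

0<δ⇒≡ : ∀ i j → 0 < δ i j → i ≡ j
0<δ⇒≡ zero    zero    _ = refl
0<δ⇒≡ (suc i) (suc j) p = cong suc (0<δ⇒≡ i j p)

-- Only an inequality, because `c` may lie outside the range of summation.
∑-δ : ∀ n {c} (f : ℕ → ℕ) → ∑ n (λ t → δ c t * f t) ≤ f c
∑-δ zero            f = z≤n
∑-δ (suc n) {zero}  f rewrite ∑-const n 0 | *-zeroʳ n = ≤-reflexive (lemma (f 0))
  where
  lemma : ∀ a → a + 0 + 0 ≡ a
  lemma = solve-∀
∑-δ (suc n) {suc c} f = ∑-δ n (f ∘ suc)

∑-δ-shift : ∀ n o {x} → o ≤ x → x < o + n → ∑ n (λ t → δ x (o + t)) ≡ 1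
∑-δ-shift n       (suc o) (s≤s o≤x) (s<s x<) = ∑-δ-shift n o o≤x x<
∑-δ-shift (suc n) zero {zero}  _ _           = cong suc (trans (∑-const n 0) (*-zeroʳ n))
∑-δ-shift (suc n) zero {suc x} _ (s<s x<)    = ∑-δ-shift n zero z≤n x<

-- For a list without repetitions this is the indicator function of its set of entries.
multiplicity : List ℕ → ℕ → ℕ
multiplicity []       i = 0
multiplicity (x ∷ xs) i = δ x i + multiplicity xs i

multiplicity⇒∈ : ∀ xs {i} → 0 < multiplicity xs i → i ∈ xs
multiplicity⇒∈ (x ∷ xs) {i} p with δ x i in eq
... | zero  = there (multiplicity⇒∈ xs p)
... | suc _ = here (sym (0<δ⇒≡ x i (subst (0 <_) (sym eq) z<s)))

unique⇒multiplicity≤1 : ∀ {xs} → Unique xs → ∀ i → multiplicity xs i ≤ 1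
unique⇒multiplicity≤1 []                    i = z≤n
unique⇒multiplicity≤1 {x ∷ xs} (x∉xs ∷ xs!) i with δ x i in eq | multiplicity xs i in eq′
... | zero  | m     = subst (_≤ 1) eq′ (unique⇒multiplicity≤1 xs! i)
... | suc d | zero  rewrite +-identityʳ d = subst (_≤ 1) eq (δ≤1 x i)
... | suc d | suc m = contradiction
  (0<δ⇒≡ x i (subst (0 <_) (sym eq) z<s))
  (All.lookup x∉xs (multiplicity⇒∈ xs (subst (0 <_) (sym eq′) z<s)))

∑-multiplicity : ∀ n o {xs} → All (λ x → o ≤ x × x < o + n) xs →
                 ∑ n (λ t → multiplicity xs (o + t)) ≡ length xs
∑-multiplicity n o []                               = trans (∑-const n 0) (*-zeroʳ n)
∑-multiplicity n o {x ∷ xs} ((o≤x , x<o+n) ∷ inside) = begin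
  ∑ n (λ t → δ x (o + t) + multiplicity xs (o + t))
    ≡⟨ ∑-+ n (λ t → δ x (o + t)) _ ⟩
  ∑ n (λ t → δ x (o + t)) + ∑ n (λ t → multiplicity xs (o + t))
    ≡⟨ cong₂ _+_ (∑-δ-shift n o o≤x x<o+n) (∑-multiplicity n o inside) ⟩
  suc (length xs) ∎
  where open ≡-Reasoning

-- Sidon sets of natural numbers and the energy of weighted windows.

-- The equation a - b = c - d is put additively, since subtraction on `ℕ` truncates.
Sidonℕ : List ℕ → Set
Sidonℕ xs = ∀ {a b c d} → a ∈ xs → b ∈ xs → c ∈ xs → d ∈ xs →
            a + d ≡ c + b → (a ≡ b × c ≡ d) ⊎ (a ≡ c × b ≡ d)

module WeightedWindows {xs : List ℕ} (xs! : Unique xs) (sidon : Sidonℕ xs)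
                       (n L : ℕ) (inside : All (λ x → n ≤ x × x < L) xs) where

  χ : ℕ → ℕ
  χ = multiplicity xs

  k : ℕ
  k = length xs

  correlation : ℕ → ℕ → ℕ
  correlation u v = ∑ L (λ t → χ (u + t) * χ (v + t))

  -- Two common indices `s` and `t` give (u + s) - (v + s) = (u + t) - (v + t). The Sidon property
  -- then offers u + s = v + s, excluded by `u ≢ v`, or u + s = u + t.
  correlation-≢ : ∀ {u v} → u ≢ v → correlation u v ≤ 1
  correlation-≢ {u} {v} u≢v = ∑-atMostOne L _
    (λ t → *-mono-≤ (unique⇒multiplicity≤1 xs! (u + t)) (unique⇒multiplicity≤1 xs! (v + t)))
    coincide
    where
    rearrange : ∀ u v s t → u + s + (v + t) ≡ u + t + (v + s)
    rearrange = solve-∀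
    ∈ˡ : ∀ t → 0 < χ (u + t) * χ (v + t) → u + t ∈ xs
    ∈ˡ t p = multiplicity⇒∈ xs (0<m*n⇒0<m (χ (u + t)) p)
    ∈ʳ : ∀ t → 0 < χ (u + t) * χ (v + t) → v + t ∈ xs
    ∈ʳ t p = multiplicity⇒∈ xs (0<m*n⇒0<n (χ (u + t)) p)
    coincide : ∀ s t → 0 < χ (u + s) * χ (v + s) → 0 < χ (u + t) * χ (v + t) → s ≡ t
    coincide s t p q with sidon (∈ˡ s p) (∈ʳ s p) (∈ˡ t q) (∈ʳ t q) (rearrange u v s t)
    ... | inj₁ (eq , _) = contradiction (+-cancelʳ-≡ s u v eq) u≢v
    ... | inj₂ (eq , _) = +-cancelˡ-≡ u s t eq

  correlation-refl : ∀ {u} → u < n → correlation u u ≤ k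
  correlation-refl {u} u<n = begin
    correlation u u
      ≤⟨ ∑-mono L (λ t _ → *-monoʳ-≤ (χ (u + t)) (unique⇒multiplicity≤1 xs! (u + t))) ⟩
    ∑ L (λ t → χ (u + t) * 1) ≡⟨ ∑-cong L (λ t _ → *-identityʳ (χ (u + t))) ⟩
    ∑ L (λ t → χ (u + t))     ≡⟨ ∑-multiplicity L u inside-u ⟩
    k                         ∎
    where
    open ≤-Reasoning
    inside-u : All (λ x → u ≤ x × x < u + L) xs
    inside-u = All.map (λ (n≤x , x<L) → ≤-trans (<⇒≤ u<n) n≤x , ≤-trans x<L (m≤n+m L u)) inside

  -- The summand 1 is kept on the diagonal too, so that in `energy-≤` it sums to the full square of
  -- `∑ n h`.
  correlation-≤ : ∀ u v → u < n → correlation u v ≤ δ u v * k + 1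
  correlation-≤ u v u<n with u ≟ v
  ... | no u≢v   = ≤-trans (correlation-≢ u≢v) (m≤n+m 1 _)
  ... | yes refl rewrite δ-refl u | +-identityʳ k = ≤-trans (correlation-refl u<n) (m≤m+n k 1)

  window : (ℕ → ℕ) → ℕ → ℕ
  window h t = ∑ n (λ u → h u * χ (u + t))

  -- Expanding the square and summing over `t` first leaves correlations. Their part `δ u v * k`
  -- yields k ∑ h², the constant 1 yields (∑ h)².
  energy-≤ : ∀ h → ∑ L (λ t → window h t * window h t) ≤ ∑ n (λ u → h u * h u) * k + ∑ n h * ∑ n h
  energy-≤ h = begin
    ∑ L (λ t → window h t * window h t)
      ≡⟨ ∑-cong L (λ t _ → ∑-product n n _ _) ⟩
    ∑ L (λ t → ∑ n (λ u → ∑ n (λ v → (h u * χ (u + t)) * (h v * χ (v + t)))))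
      ≡⟨ ∑-swap L n _ ⟩
    ∑ n (λ u → ∑ L (λ t → ∑ n (λ v → (h u * χ (u + t)) * (h v * χ (v + t)))))
      ≡⟨ ∑-cong n (λ u _ → ∑-swap L n _) ⟩
    ∑ n (λ u → ∑ n (λ v → ∑ L (λ t → (h u * χ (u + t)) * (h v * χ (v + t)))))
      ≡⟨ ∑-cong n (λ u _ → ∑-cong n (λ v _ →
           trans (∑-cong L (λ t _ → [m*n]*[o*p]≡[m*o]*[n*p] (h u) _ (h v) _)) (∑-*ˡ L (h u * h v) _))) ⟩
    ∑ n (λ u → ∑ n (λ v → h u * h v * correlation u v))
      ≤⟨ ∑-mono n (λ u u<n → ∑-mono n (λ v _ → *-monoʳ-≤ (h u * h v) (correlation-≤ u v u<n))) ⟩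
    ∑ n (λ u → ∑ n (λ v → h u * h v * (δ u v * k + 1)))
      ≡⟨ ∑-cong n (λ u _ → trans (∑-cong n (λ v _ → distribute (h u) (h v) (δ u v) k)) (∑-+ n _ _)) ⟩
    ∑ n (λ u → ∑ n (λ v → δ u v * (h u * h v * k)) + ∑ n (λ v → h u * h v))
      ≤⟨ ∑-mono n (λ u _ → +-monoˡ-≤ _ (∑-δ n (λ v → h u * h v * k))) ⟩
    ∑ n (λ u → h u * h u * k + ∑ n (λ v → h u * h v))
      ≡⟨ ∑-+ n _ _ ⟩
    ∑ n (λ u → h u * h u * k) + ∑ n (λ u → ∑ n (λ v → h u * h v))
      ≡⟨ cong₂ _+_ (∑-*ʳ n k _) (sym (∑-product n n h h)) ⟩
    ∑ n (λ u → h u * h u) * k + ∑ n h * ∑ n h ∎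
    where
    open ≤-Reasoning
    distribute : ∀ a b d k → a * b * (d * k + 1) ≡ d * (a * b * k) + a * b
    distribute = solve-∀

-- Step functions.

-- After the first `T` places `g` is read from its own origin, so nested blocks form a function with
-- steps of length `T`.
block : ℕ → ℕ → (ℕ → ℕ) → ℕ → ℕ
block zero    c g t       = g t
block (suc T) c g zero    = c
block (suc T) c g (suc t) = block T c g t

block-shift : ∀ T c g t → block T c g (T + t) ≡ g t
block-shift zero    c g t = refl
block-shift (suc T) c g t = block-shift T c g t

block-all : ∀ (P : ℕ → Set) T {c g} → P c → (∀ t → P (g t)) → ∀ t → P (block T c g t)
block-all P zero    p q t       = q t
block-all P (suc T) p q zero    = p
block-all P (suc T) p q (suc t) = block-all P T p q t

block-zip : ∀ (P : ℕ → ℕ → Set) T {c d f g} → P c d → (∀ t → P (f t) (g t)) →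
            ∀ t → P (block T c f t) (block T d g t)
block-zip P zero    p q t       = q t
block-zip P (suc T) p q zero    = p
block-zip P (suc T) p q (suc t) = block-zip P T p q t

∑-block : ∀ T n {c g} (φ : ℕ → ℕ → ℕ) →
          ∑ (T + n) (λ t → φ (block T c g t) t) ≡ ∑ T (φ c) + ∑ n (λ t → φ (g t) (T + t))
∑-block zero    n         φ = refl
∑-block (suc T) n {c} φ = trans (cong (φ c 0 +_) (∑-block T n λ x t → φ x (suc t)))
                                (sym (+-assoc (φ c 0) _ _))

∑-block-map : ∀ T n {c g} (φ : ℕ → ℕ) →
              ∑ (T + n) (λ t → φ (block T c g t)) ≡ T * φ c + ∑ n (φ ∘ g)
∑-block-map T n {c} φ = trans (∑-block T n (const ∘ φ)) (cong (_+ _) (∑-const T (φ c)))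

-- The length inequality from the two-step weight.

module TwoStep (T p : ℕ) {xs : List ℕ} (xs! : Unique xs) (sidon : Sidonℕ xs)
               (inside : All (λ x → T + T ≤ x × x < T + (T + (T + (T + p)))) xs) where

  -- The elements start at 2T, so that every window meeting them has an index t ≥ 0.
  L′ L : ℕ
  L′ = T + (T + (T + p))
  L = T + L′

  open WeightedWindows xs! sidon (T + T) L inside

  h : ℕ → ℕ
  h = block T 2 (const 1)

  F : ℕ → ℕ
  F = window h

  W : ℕ → ℕ
  W t = ∑ T (λ u → χ (u + t))

  F≡ : ∀ t → F t ≡ 2 * W t + W (T + t)
  F≡ t = trans (∑-block T T (λ x u → x * χ (u + t)))
    (cong₂ _+_ (∑-*ˡ T 2 _) (∑-cong T (λ u _ → trans (*-identityˡ _) (cong χ (lemma T u t)))))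
    where
    lemma : ∀ a b c → a + b + c ≡ b + (a + c)
    lemma = solve-∀

  -- The solution 16 + 16(−1/2)ⁱ, i ≥ 1, of the recurrence 2ρᵢ₊₁ + ρᵢ = 48, replaced by 16 after i = 4.
  ρ₅ ρ₄ ρ₃ ρ₂ ρ₁ : ℕ → ℕ
  ρ₅ = const 16
  ρ₄ = block T 17 ρ₅
  ρ₃ = block T 14 ρ₄
  ρ₂ = block T 20 ρ₃
  ρ₁ = block T 8 ρ₂

  48≤ : ∀ t → 48 ≤ ρ₁ (T + t) * 2 + ρ₁ t
  48≤ t rewrite block-shift T 8 ρ₂ t =
    -- Block by block the pair (x, y) is (20, 8), (14, 20), (17, 14), (16, 17), (16, 16); here 2x +
    -- y is 49 for the fourth pair and 48 for the others.
    block-zip P T ok (block-zip P T ok (block-zip P T ok (block-all (P 16) T ok λ _ → ok))) t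
    where
    P : ℕ → ℕ → Set
    P x y = 48 ≤ x * 2 + y
    ok : ∀ {x} → 48 ≤ 48 + x
    ok = m≤m+n 48 _

  -- With N = 2T + p the length of the interval, the right side is 256N + 437T; the oscillation at
  -- the left end is part of the 437T.
  ∑ρ²≡ : ∑ L (λ t → ρ₁ t * ρ₁ t) ≡ 949 * T + 256 * p
  ∑ρ²≡ = begin
    ∑ L (sq ∘ ρ₁)                                          ≡⟨ ∑-block-map T _ sq ⟩
    T * 64 + ∑ L′ (sq ∘ ρ₂)                                 ≡⟨ cong (T * 64 +_) (∑-block-map T _ sq) ⟩
    T * 64 + (T * 400 + ∑ (T + (T + p)) (sq ∘ ρ₃))          ≡⟨ cong (λ x → T * 64 + (T * 400 + x)) (∑-block-map T _ sq) ⟩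
    T * 64 + (T * 400 + (T * 196 + ∑ (T + p) (sq ∘ ρ₄)))    ≡⟨ cong (λ x → T * 64 + (T * 400 + (T * 196 + x)))
                                                                     (trans (∑-block-map T p sq) (cong (T * 289 +_) (∑-const p 256))) ⟩
    T * 64 + (T * 400 + (T * 196 + (T * 289 + p * 256)))    ≡⟨ lemma T p ⟩
    949 * T + 256 * p ∎
    where
    open ≡-Reasoning
    sq : ℕ → ℕ
    sq x = x * x
    lemma : ∀ T p → T * 64 + (T * 400 + (T * 196 + (T * 289 + p * 256))) ≡ 949 * T + 256 * p
    lemma = solve-∀

  ∑F²≤ : ∑ L (λ t → F t * F t) ≤ 5 * T * k + 9 * (T * T)
  ∑F²≤ = ≤-trans (energy-≤ h) (≤-reflexive (cong₂ _+_
    (cong (_* k) (trans (∑-block-map T T (λ x → x * x)) (trans (cong (T * 4 +_) (∑-const T 1)) (five T))))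
    (trans (cong (λ x → x * x) (trans (∑-block-map T T (λ x → x)) (cong (T * 2 +_) (∑-const T 1)))) (nine T))))
    where
    five : ∀ T → T * 4 + T * 1 ≡ 5 * T
    five = solve-∀
    nine : ∀ T → (T * 2 + T * 1) * (T * 2 + T * 1) ≡ 9 * (T * T)
    nine = solve-∀

  -- An element x is counted once for each offset `u < T`. Its window index x - u is at least `T`
  -- because x ≥ 2T, so starting at `T` loses nothing.
  ∑W≡ : ∑ L′ (λ t → W (T + t)) ≡ T * k
  ∑W≡ = begin
    ∑ L′ (λ t → ∑ T (λ u → χ (u + (T + t)))) ≡⟨ ∑-swap L′ T _ ⟩
    ∑ T (λ u → ∑ L′ (λ t → χ (u + (T + t)))) ≡⟨ ∑-cong T column ⟩
    ∑ T (const k)                            ≡⟨ ∑-const T k ⟩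
    T * k                                    ∎
    where
    open ≡-Reasoning
    column : ∀ u → u < T → ∑ L′ (λ t → χ (u + (T + t))) ≡ k
    column u u<T = trans (∑-cong L′ (λ t _ → cong χ (sym (+-assoc u T t))))
      (∑-multiplicity L′ (u + T) (All.map
        (λ (2T≤x , x<L) → ≤-trans (+-monoˡ-≤ T (<⇒≤ u<T)) 2T≤x
                        , ≤-trans x<L (≤-trans (m≤n+m L u) (≤-reflexive (sym (+-assoc u T L′)))))
        inside))

  -- `W (T + t)` enters `F (T + t)` with coefficient 2 and `F t` with coefficient 1, so its total
  -- weight is the one bounded in `48≤`. Terms without a partner at the two ends are nonnegative and
  -- dropped.
  ∑ρF≥ : 48 * (T * k) ≤ ∑ L (λ t → ρ₁ t * F t)
  ∑ρF≥ = begin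
    48 * (T * k)
      ≡⟨ cong (48 *_) ∑W≡ ⟨
    48 * ∑ L′ (λ t → W (T + t))
      ≡⟨ ∑-*ˡ L′ 48 _ ⟨
    ∑ L′ (λ t → 48 * W (T + t))
      ≤⟨ ∑-mono L′ (λ t _ → *-monoˡ-≤ (W (T + t)) (48≤ t)) ⟩
    ∑ L′ (λ t → (ρ₁ (T + t) * 2 + ρ₁ t) * W (T + t))
      ≡⟨ ∑-cong L′ (λ t _ → distribute (ρ₁ (T + t)) (ρ₁ t) (W (T + t))) ⟩
    ∑ L′ (λ t → ρ₁ (T + t) * (2 * W (T + t)) + ρ₁ t * W (T + t))
      ≡⟨ ∑-+ L′ _ _ ⟩
    ∑ L′ (λ t → ρ₁ (T + t) * (2 * W (T + t))) + ∑ L′ (λ t → ρ₁ t * W (T + t))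
      ≤⟨ +-mono-≤ (∑-suffix T L′ (λ t → ρ₁ t * (2 * W t))) (∑-prefix T L′ (λ t → ρ₁ t * W (T + t))) ⟩
    ∑ L (λ t → ρ₁ t * (2 * W t)) + ∑ L (λ t → ρ₁ t * W (T + t))
      ≡⟨ ∑-+ L _ _ ⟨
    ∑ L (λ t → ρ₁ t * (2 * W t) + ρ₁ t * W (T + t))
      ≡⟨ ∑-cong L (λ t _ → trans (sym (*-distribˡ-+ (ρ₁ t) _ _)) (cong (ρ₁ t *_) (sym (F≡ t)))) ⟩
    ∑ L (λ t → ρ₁ t * F t) ∎
    where
    open ≤-Reasoning
    distribute : ∀ a b w → (a * 2 + b) * w ≡ a * (2 * w) + b * w
    distribute = solve-∀

  -- In the bulk F ≈ 3T/k and ρ = 16, which dictates the multipliers 16k and 3T.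
  length-≤ : T * (T * (45 * (k * k))) ≤ T * (25 * (k * k * k) + T * (167 * T + 45 * p))
  -- The term 11520 k² T² is the share of 9T² from `∑F²≤`; it is carried on both sides and
  -- cancelled. A factor `T` stays on both sides, since `T` may be 0 here.
  length-≤ = *-cancelˡ-≤ 256 (+-cancelʳ-≤ (11520 * (k * k) * (T * T)) _ _ (begin
    256 * (T * (T * (45 * (k * k)))) + 11520 * (k * k) * (T * T)
      ≡⟨ left T k ⟩
    5 * (2 * (3 * T * (16 * k)) * (48 * (T * k)))
      ≤⟨ *-monoʳ-≤ 5 (*-monoʳ-≤ (2 * (3 * T * (16 * k))) ∑ρF≥) ⟩
    5 * (2 * (3 * T * (16 * k)) * ∑ L (λ t → ρ₁ t * F t))
      ≤⟨ *-monoʳ-≤ 5 (∑-amgm L (3 * T) (16 * k) ρ₁ F) ⟩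
    5 * (3 * T * (3 * T) * ∑ L (λ t → ρ₁ t * ρ₁ t) + 16 * k * (16 * k) * ∑ L (λ t → F t * F t))
      ≤⟨ *-monoʳ-≤ 5 (+-mono-≤ (≤-reflexive (cong (3 * T * (3 * T) *_) ∑ρ²≡))
                               (*-monoʳ-≤ (16 * k * (16 * k)) ∑F²≤)) ⟩
    5 * (3 * T * (3 * T) * (949 * T + 256 * p) + 16 * k * (16 * k) * (5 * T * k + 9 * (T * T)))
      -- Since 5·9·949 + 47 = 256·167, this rounds the coefficient up to 167.
      ≤⟨ m≤m+n _ (47 * (T * T * T)) ⟩
    5 * (3 * T * (3 * T) * (949 * T + 256 * p) + 16 * k * (16 * k) * (5 * T * k + 9 * (T * T))) + 47 * (T * T * T)
      ≡⟨ right T k p ⟩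
    256 * (T * (25 * (k * k * k) + T * (167 * T + 45 * p))) + 11520 * (k * k) * (T * T) ∎))
    where
    open ≤-Reasoning
    left : ∀ T k →
      256 * (T * (T * (45 * (k * k)))) + 11520 * (k * k) * (T * T)
      ≡ 5 * (2 * (3 * T * (16 * k)) * (48 * (T * k)))
    left = solve-∀
    right : ∀ T k p →
      5 * (3 * T * (3 * T) * (949 * T + 256 * p) + 16 * k * (16 * k) * (5 * T * k + 9 * (T * T))) + 47 * (T * T * T)
      ≡ 256 * (T * (25 * (k * k * k) + T * (167 * T + 45 * p))) + 11520 * (k * k) * (T * T)
    right = solve-∀

-- Transfer to the integers by translation.

open import Data.Integer using (+_; -[1+_]; ∣_∣; +≤+; -≤+)

module Translate (c : ℤ) where

  g : ℕ → ℤ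
  g n = + n ℤ.+ c

  g-injective : ∀ {m n} → g m ≡ g n → m ≡ n
  g-injective {m} {n} eq = ℤ.+-injective (ℤ-Group.∙-cancelʳ c (+ m) (+ n) eq)

  unique : ∀ {xs} → Unique (map g xs) → Unique xs
  unique = AllPairs.map (λ gx≢gy x≡y → gx≢gy (cong g x≡y)) ∘ AllPairs.map⁻

  sidon : ∀ {xs} → Sidon (map g xs) → Sidonℕ xs
  sidon sid {x} {y} {z} {w} x∈ y∈ z∈ w∈ eq =
    Sum.map (Product.map g-injective g-injective) (Product.map g-injective g-injective)
      (sid (∈-map⁺ g x∈) (∈-map⁺ g y∈) (∈-map⁺ g z∈) (∈-map⁺ g w∈) differences)
    where
    open ≡-Reasoning
    before : ∀ x y w c → (x ℤ.+ c) ℤ.- (y ℤ.+ c) ≡ (x ℤ.+ w) ℤ.- (y ℤ.+ w)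
    before = ℤ-RingSolver.solve-∀
    after : ∀ y z w c → (z ℤ.+ y) ℤ.- (y ℤ.+ w) ≡ (z ℤ.+ c) ℤ.- (w ℤ.+ c)
    after = ℤ-RingSolver.solve-∀
    differences : g x ℤ.- g y ≡ g z ℤ.- g w
    differences = begin
      -- The common shift `c` is traded for `w`, so that `x + w` appears and `eq` applies;
      -- afterwards `y` is traded for `c`.
      g x ℤ.- g y                         ≡⟨ before (+ x) (+ y) (+ w) c ⟩
      + (x + w) ℤ.- (+ y ℤ.+ + w)         ≡⟨ cong (λ s → + s ℤ.- (+ y ℤ.+ + w)) eq ⟩
      + (z + y) ℤ.- (+ y ℤ.+ + w)         ≡⟨ after (+ y) (+ z) (+ w) c ⟩
      g z ℤ.- g w                         ∎

integer-length-≤ : ∀ T p lo zs → Unique zs → Sidon zs →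
  All (λ z → lo ℤ.≤ z × z ℤ.< lo ℤ.+ + (T + (T + p))) zs →
  T * (T * (45 * (length zs * length zs))) ≤
  T * (25 * (length zs * length zs * length zs) + T * (167 * T + 45 * p))
integer-length-≤ T p lo zs zs! sid inside =
  subst (λ k → T * (T * (45 * (k * k))) ≤ T * (25 * (k * k * k) + T * (167 * T + 45 * p)))
    (length-map f zs)
    (TwoStep.length-≤ T p
      (Translate.unique c (subst Unique (sym (recover inside)) zs!))
      (Translate.sidon c (subst Sidon (sym (recover inside)) sid))
      (All.map⁺ (All.map bounds inside)))
  where
  c : ℤ
  -- This sends `lo` to 2T, the least value that `TwoStep` admits.
  c = lo ℤ.- + (T + T)

  f : ℤ → ℕ
  f z = ∣ z ℤ.- c ∣

  regroup : ∀ z lo t → z ℤ.- (lo ℤ.- t) ≡ t ℤ.+ (z ℤ.- lo)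
  regroup = ℤ-RingSolver.solve-∀

  +f≡ : ∀ {z} → lo ℤ.≤ z → + f z ≡ z ℤ.- c
  +f≡ {z} lo≤z = ℤ.0≤i⇒+∣i∣≡i (subst (+ 0 ℤ.≤_) (sym (regroup z lo (+ (T + T))))
    (ℤ.+-mono-≤ (+≤+ {0} {T + T} z≤n) (ℤ.i≤j⇒0≤j-i lo≤z)))

  -- `Translate` treats lists of the form `map g xs`; this brings `zs` into that form. The absolute
  -- value in `f` is harmless because z - c ≥ 0.
  recover : ∀ {zs} → All (λ z → lo ℤ.≤ z × z ℤ.< lo ℤ.+ + (T + (T + p))) zs →
            map (Translate.g c) (map f zs) ≡ zs
  recover []                          = refl
  recover {z ∷ _} ((lo≤z , _) ∷ rest) =
    cong₂ _∷_ (trans (cong (ℤ._+ c) (+f≡ lo≤z)) (cancel z c)) (recover rest)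
    where
    cancel : ∀ z c → z ℤ.- c ℤ.+ c ≡ z
    cancel = ℤ-RingSolver.solve-∀

  bounds : ∀ {z} → lo ℤ.≤ z × z ℤ.< lo ℤ.+ + (T + (T + p)) →
           T + T ≤ f z × f z < T + (T + (T + (T + p)))
  bounds {z} (lo≤z , z<hi) =
    ℤ.drop‿+≤+ (subst (+ (T + T) ℤ.≤_) (sym f≡)
      (subst (ℤ._≤ + (T + T) ℤ.+ (z ℤ.- lo)) (ℤ.+-identityʳ (+ (T + T)))
        (ℤ.+-monoʳ-≤ (+ (T + T)) (ℤ.i≤j⇒0≤j-i lo≤z)))) ,
    subst (f z <_) (+-assoc T T _) (ℤ.drop‿+<+ (subst₂ ℤ._<_ (sym f≡) (back lo (+ (T + T)) (+ (T + (T + p))))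
      (ℤ.+-monoʳ-< (+ (T + T)) (ℤ.+-monoˡ-< (ℤ.- lo) z<hi))))
    where
    f≡ : + f z ≡ + (T + T) ℤ.+ (z ℤ.- lo)
    f≡ = trans (+f≡ lo≤z) (regroup z lo (+ (T + T)))
    back : ∀ lo t n → t ℤ.+ (lo ℤ.+ n ℤ.- lo) ≡ t ℤ.+ n
    back = ℤ-RingSolver.solve-∀


-- Choice of the window length and numerical estimates.

-- T = 4m with k³ ≈ (7m)² is close to the minimiser of (437/256) T + (5/9) k³/T.
width-≥ : ∀ m p k .{{_ : NonZero m}} → k * k * k < 49 * ((m + 1) * (m + 1)) →
  let T = 4 * m in
  T * (T * (45 * (k * k))) ≤ T * (25 * (k * k * k) + T * (167 * T + 45 * p)) →
  10 * (k * k) ≤ 10 * (T + (T + p)) + (137 * m + 205)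
-- 12250 = 10·25·49 is the constant term coming from (m + 1)². The added `90 * (m * m) + 12400 * m`
-- exceeds it for m ≥ 1 and makes the other coefficients 180·217 and 180·205.
width-≥ m@(suc _) p k k³< bound = *-cancelˡ-≤ (180 * m) (+-cancelʳ-≤ 12250 _ _ (begin
  180 * m * (10 * (k * k)) + 12250
    ≡⟨ cong (_+ 12250) (left m (k * k)) ⟩
  10 * (T * (45 * (k * k))) + 12250
    ≤⟨ +-mono-≤ (*-monoʳ-≤ 10 (*-cancelˡ-≤ T bound)) 12250≤ ⟩
  10 * (25 * (k * k * k) + T * (167 * T + 45 * p)) + (90 * (m * m) + 12400 * m)
    ≤⟨ +-monoˡ-≤ _ (*-monoʳ-≤ 10 (+-monoˡ-≤ _ (*-monoʳ-≤ 25 (<⇒≤ k³<)))) ⟩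
  10 * (25 * (49 * ((m + 1) * (m + 1))) + T * (167 * T + 45 * p)) + (90 * (m * m) + 12400 * m)
    ≡⟨ right m p ⟩
  180 * m * (10 * (T + (T + p)) + (137 * m + 205)) + 12250 ∎))
  where
  open ≤-Reasoning
  T = 4 * m
  12250≤ : 12250 ≤ 90 * (m * m) + 12400 * m
  12250≤ = begin
    12250                       ≤⟨ m≤m+n 12250 150 ⟩
    12400                       ≤⟨ m≤m*n 12400 m ⟩
    12400 * m                   ≤⟨ m≤n+m (12400 * m) (90 * (m * m)) ⟩
    90 * (m * m) + 12400 * m    ∎
  left : ∀ m x → 180 * m * (10 * x) ≡ 10 * (4 * m * (45 * x))
  left = solve-∀
  right : ∀ m p →
    10 * (25 * (49 * ((m + 1) * (m + 1))) + 4 * m * (167 * (4 * m) + 45 * p)) + (90 * (m * m) + 12400 * m)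
    ≡ 180 * m * (10 * (4 * m + (4 * m + p)) + (137 * m + 205)) + 12250
  right = solve-∀

-- The witness is the integer part of √(x/49), found by counting up to `x`. For x = k³ this says 7m
-- ≤ k^(3/2) < 7(m + 1).
scaledSqrt : ∀ x → ∃ λ m → 49 * (m * m) ≤ x × x < 49 * ((m + 1) * (m + 1))
scaledSqrt zero = 0 , z≤n , z<s
scaledSqrt (suc x) with scaledSqrt x
... | m , lower , upper with suc x <? 49 * ((m + 1) * (m + 1))
... | yes below = m , m≤n⇒m≤1+n lower , below
... | no  above = m + 1 , ≮⇒≥ above , ≤-<-trans upper
  (*-monoʳ-< 49 (*-mono-< (m<m+n (m + 1) z<s) (m<m+n (m + 1) z<s)))

-- Otherwise 10k² ≤ 422m, while (422m)² < 100·207·49m² ≤ 100k⁴. This serves to exclude intervals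
-- shorter than 8m.
217m+205<10k² : ∀ m k .{{_ : NonZero m}} → 206 < k → 49 * (m * m) ≤ k * k * k →
                217 * m + 205 < 10 * (k * k)
217m+205<10k² m k 206<k m²≤k³ = ≰⇒> λ 10k²≤ → <-irrefl refl (begin-strict
  422 * m * (422 * m)            ≡⟨ [m*n]*[o*p]≡[m*o]*[n*p] 422 m 422 m ⟩
  422 * 422 * (m * m)            <⟨ *-monoˡ-< (m * m) {{m*n≢0 m m}} (<ᵇ⇒< (422 * 422) (100 * 207 * 49) tt) ⟩
  100 * 207 * 49 * (m * m)       ≡⟨ *-assoc (100 * 207) 49 (m * m) ⟩
  100 * 207 * (49 * (m * m))     ≤⟨ *-mono-≤ (*-monoʳ-≤ 100 206<k) m²≤k³ ⟩
  100 * k * (k * k * k)          ≡⟨ fourth 10 k ⟩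
  10 * (k * k) * (10 * (k * k))  ≤⟨ *-mono-≤ (≤-trans 10k²≤ ≤422m) (≤-trans 10k²≤ ≤422m) ⟩
  422 * m * (422 * m)            ∎)
  where
  open ≤-Reasoning
  fourth : ∀ a k → a * a * k * (k * k * k) ≡ a * (k * k) * (a * (k * k))
  fourth = solve-∀
  ≤422m : 217 * m + 205 ≤ 422 * m
  ≤422m = begin
    217 * m + 205      ≤⟨ +-monoʳ-≤ (217 * m) (m≤m*n 205 m) ⟩
    217 * m + 205 * m  ≡⟨ *-distribʳ-+ m 217 205 ⟨
    422 * m            ∎

-- From the width estimate to the bound without square roots.

-- For R = k² - 206k - d the hypotheses give 10R ≤ 137m and 7m ≤ k^(3/2), so R ≤ (13.7/7) k^(3/2),
-- and 13.7/7 < 1.96365.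
diamBound : ∀ k d m → 10 * (k * k) ≤ 10 * (206 * k + d) + 137 * m → 49 * (m * m) ≤ k * k * k →
            DiamBound 206 k (+ d)
diamBound k d m k²≤ m²≤k³ =
  cases 10000 196365 100000 (≤ᵇ⇒≤ (10000 * 137) (196365 * 7) tt) refl
    (+ k ℤ.* + k ℤ.- + 206 ℤ.* + k ℤ.- + d) 10R≤137m
  where
  isolate : ∀ x y d → + 10 ℤ.* x ℤ.- + 10 ℤ.* (y ℤ.+ d) ≡ + 10 ℤ.* (x ℤ.- y ℤ.- d)
  isolate = ℤ-RingSolver.solve-∀

  cancel : ∀ x y → x ℤ.+ y ℤ.- x ≡ y
  cancel = ℤ-RingSolver.solve-∀

  10R≤137m : + 10 ℤ.* (+ k ℤ.* + k ℤ.- + 206 ℤ.* + k ℤ.- + d) ℤ.≤ + (137 * m)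
  10R≤137m = subst₂ ℤ._≤_ lhs (cancel (+ (10 * (206 * k + d))) (+ (137 * m)))
    (ℤ.+-monoˡ-≤ (ℤ.- + (10 * (206 * k + d))) (+≤+ k²≤))
    where
    lhs : + (10 * (k * k)) ℤ.- + (10 * (206 * k + d)) ≡ + 10 ℤ.* (+ k ℤ.* + k ℤ.- + 206 ℤ.* + k ℤ.- + d)
    lhs = trans
      (cong₂ ℤ._-_ (trans (ℤ.pos-* 10 (k * k)) (cong (+ 10 ℤ.*_) (ℤ.pos-* k k)))
                   (trans (ℤ.pos-* 10 (206 * k + d)) (cong (λ x → + 10 ℤ.* (x ℤ.+ + d)) (ℤ.pos-* 206 k))))
      (isolate ((+ k) ℤ.* (+ k)) (+ 206 ℤ.* (+ k)) (+ d))

  pos-square : ∀ a r b x → a * r * (a * r) ≤ b * b * x →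
               + a ℤ.* + r ℤ.* (+ a ℤ.* + r) ℤ.≤ + b ℤ.* + b ℤ.* + x
  pos-square a r b x le = subst₂ ℤ._≤_
    (trans (ℤ.pos-* (a * r) (a * r)) (cong₂ ℤ._*_ (ℤ.pos-* a r) (ℤ.pos-* a r)))
    (trans (ℤ.pos-* (b * b) x) (cong (ℤ._* + x) (ℤ.pos-* b b)))
    (+≤+ le)

  K³≡ : + (k * k * k) ≡ + k ℤ.* + k ℤ.* + k
  K³≡ = trans (ℤ.pos-* (k * k) k) (cong (ℤ._* (+ k)) (ℤ.pos-* k k))

  square-≤ : ∀ a b r → a * r ≤ b * (7 * m) → a * r * (a * r) ≤ b * b * (k * k * k)
  square-≤ a b r ar≤ = begin
    a * r * (a * r)               ≤⟨ *-mono-≤ ar≤ ar≤ ⟩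
    b * (7 * m) * (b * (7 * m))   ≡⟨ regroup b m ⟩
    b * b * (49 * (m * m))        ≤⟨ *-monoʳ-≤ (b * b) m²≤k³ ⟩
    b * b * (k * k * k)           ∎
    where
    open ≤-Reasoning
    regroup : ∀ b m → b * (7 * m) * (b * (7 * m)) ≡ b * b * (49 * (m * m))
    regroup = solve-∀

  scale : ∀ a b c r → a * 137 ≤ b * 7 → c ≡ a * 10 → 10 * r ≤ 137 * m → c * r ≤ b * (7 * m)
  scale a b _ r 137a≤7b refl 10r≤ = begin
    a * 10 * r       ≡⟨ *-assoc a 10 r ⟩
    a * (10 * r)     ≤⟨ *-monoʳ-≤ a 10r≤ ⟩
    a * (137 * m)    ≡⟨ *-assoc a 137 m ⟨
    a * 137 * m      ≤⟨ *-monoˡ-≤ m 137a≤7b ⟩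
    b * 7 * m        ≡⟨ *-assoc b 7 m ⟩
    b * (7 * m)      ∎
    where open ≤-Reasoning

  -- The constants are abstracted because Agda would unfold 100000 * r 100000 times.
  cases : ∀ a b c → a * 137 ≤ b * 7 → c ≡ a * 10 → ∀ R → + 10 ℤ.* R ℤ.≤ + (137 * m) →
          R ℤ.≤ + 0 ⊎ + c ℤ.* R ℤ.* (+ c ℤ.* R) ℤ.≤ + b ℤ.* + b ℤ.* (+ k ℤ.* + k ℤ.* + k)
  cases a b c 137a≤7b c≡10a -[1+ n ] _  = inj₁ -≤+
  cases a b c 137a≤7b c≡10a (+ r)    le =
    inj₂ (subst (λ x → + c ℤ.* + r ℤ.* (+ c ℤ.* + r) ℤ.≤ + b ℤ.* + b ℤ.* x) K³≡
      (pos-square c r b (k * k * k) (square-≤ c b r (scale a b c r 137a≤7b c≡10a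
        (ℤ.drop‿+≤+ (subst (ℤ._≤ + (137 * m)) (sym (ℤ.pos-* 10 r)) le))))))

-- Extremes of a list, and the cases of long and short sets.

minL-≤ : ∀ a as → All (minL a as ℤ.≤_) (a ∷ as)
minL-≤ a []       = ℤ.≤-refl ∷ []
minL-≤ a (b ∷ bs) with minL-≤ a bs
... | min≤a ∷ min≤bs =
  ℤ.≤-trans (ℤ.i⊓j≤j b _) min≤a ∷ ℤ.i⊓j≤i b _ ∷
  All.map (ℤ.≤-trans (ℤ.i⊓j≤j b _)) min≤bs

≤-maxL : ∀ a as → All (ℤ._≤ maxL a as) (a ∷ as)
≤-maxL a []       = ℤ.≤-refl ∷ []
≤-maxL a (b ∷ bs) with ≤-maxL a bs
... | a≤max ∷ bs≤max =
  ℤ.≤-trans a≤max (ℤ.i≤j⊔i b _) ∷ ℤ.i≤i⊔j b _ ∷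
  All.map (λ z≤ → ℤ.≤-trans z≤ (ℤ.i≤j⊔i b _)) bs≤max

scaledSqrt-nonZero : ∀ m k → 49 ≤ k → k * k * k < 49 * ((m + 1) * (m + 1)) → NonZero m
scaledSqrt-nonZero zero      k 49≤k k³< =
  contradiction (*-mono-≤ (*-mono-≤ 1≤k 1≤k) 49≤k) (<⇒≱ k³<)
  where
  1≤k : 1 ≤ k
  1≤k = ≤-trans (s≤s z≤n) 49≤k
scaledSqrt-nonZero m@(suc _) k 49≤k k³< = _

module LongSidon (lo : ℤ) (d m : ℕ) .{{_ : NonZero m}} (zs : List ℤ)
                 (zs! : Unique zs) (sidon : Sidon zs)
                 (inside : All (λ z → lo ℤ.≤ z × z ℤ.≤ lo ℤ.+ + d) zs)
                 (206<k : 206 < length zs)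
                 (lower : 49 * (m * m) ≤ length zs * length zs * length zs)
                 (upper : length zs * length zs * length zs < 49 * ((m + 1) * (m + 1))) where

  k : ℕ
  k = length zs

  interval-≥ : ∀ p → d < 4 * m + (4 * m + p) →
               10 * (k * k) ≤ 10 * (4 * m + (4 * m + p)) + (137 * m + 205)
  interval-≥ p d< = width-≥ m p k upper (integer-length-≤ (4 * m) p lo zs zs! sidon
    (All.map (λ (lo≤z , z≤hi) → lo≤z , ℤ.≤-<-trans z≤hi (ℤ.+-monoʳ-< lo (ℤ.+<+ d<))) inside))

  -- A set with d < 8m would fit into an interval with p = 0, where `interval-≥` contradicts
  -- `217m+205<10k²`.
  8m≤d : 4 * m + (4 * m + 0) ≤ d
  8m≤d = ≮⇒≥ λ d<8m → <⇒≱ (217m+205<10k² m k 206<k lower)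
    (subst (10 * (k * k) ≤_) (collect m) (interval-≥ 0 d<8m))
    where
    collect : ∀ m → 10 * (4 * m + (4 * m + 0)) + (137 * m + 205) ≡ 217 * m + 205
    collect = solve-∀

  width : 10 * (k * k) ≤ 10 * (206 * k + d) + 137 * m
  width = begin
    10 * (k * k)                                      ≤⟨ interval-≥ p (≤-reflexive (sym N≡)) ⟩
    10 * (4 * m + (4 * m + p)) + (137 * m + 205)      ≡⟨ cong (λ N → 10 * N + (137 * m + 205)) N≡ ⟩
    10 * suc d + (137 * m + 205)                      ≡⟨ collect d m ⟩
    -- The 205, and the 10 from replacing `d` by `suc d`, are absorbed by the linear term.
    215 + (10 * d + 137 * m)                          ≤⟨ +-monoˡ-≤ _ 215≤ ⟩
    10 * (206 * k) + (10 * d + 137 * m)               ≡⟨ distribute (206 * k) d m ⟩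
    10 * (206 * k + d) + 137 * m                      ∎
    where
    open ≤-Reasoning
    p : ℕ
    -- The interval from lo to lo + d contains d + 1 integers; `8m≤d` makes the truncated
    -- subtraction exact.
    p = suc d ∸ (4 * m + (4 * m + 0))
    N≡ : 4 * m + (4 * m + p) ≡ suc d
    N≡ = trans (reassociate (4 * m) p) (m+[n∸m]≡n (m≤n⇒m≤1+n 8m≤d))
      where
      reassociate : ∀ T p → T + (T + p) ≡ T + (T + 0) + p
      reassociate = solve-∀
    collect : ∀ d m → 10 * suc d + (137 * m + 205) ≡ 215 + (10 * d + 137 * m)
    collect = solve-∀
    distribute : ∀ x d m → 10 * x + (10 * d + 137 * m) ≡ 10 * (x + d) + 137 * m
    distribute = solve-∀
    215≤ : 215 ≤ 10 * (206 * k)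
    215≤ = ≤-trans (≤ᵇ⇒≤ 215 (10 * (206 * 1)) tt)
      (*-monoʳ-≤ 10 (*-monoʳ-≤ 206 (≤-trans (s≤s z≤n) 206<k)))

-- For k ≤ 206 the linear term alone suffices, as k² ≤ 206k; thus 206 is both the constant and the
-- threshold.
10k²≤ : ∀ lo d m zs → Unique zs → Sidon zs → All (λ z → lo ℤ.≤ z × z ℤ.≤ lo ℤ.+ + d) zs →
       let k = length zs in
       49 * (m * m) ≤ k * k * k → k * k * k < 49 * ((m + 1) * (m + 1)) →
       10 * (k * k) ≤ 10 * (206 * k + d) + 137 * m
10k²≤ lo d m zs zs! sidon inside lower upper = [ short , long ]′ (≤-<-connex (length zs) 206)
  where
  short : length zs ≤ 206 → 10 * (length zs * length zs) ≤ 10 * (206 * length zs + d) + 137 * m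
  short k≤206 = ≤-trans
    (*-monoʳ-≤ 10 (≤-trans (*-monoˡ-≤ (length zs) k≤206) (m≤m+n (206 * length zs) d)))
    (m≤m+n (10 * (206 * length zs + d)) (137 * m))

  long : 206 < length zs → 10 * (length zs * length zs) ≤ 10 * (206 * length zs + d) + 137 * m
  long 206<k = LongSidon.width lo d m
    {{scaledSqrt-nonZero m (length zs) (≤-trans (m≤m+n 49 158) 206<k) upper}}
    zs zs! sidon inside 206<k lower upper

sidon-diamBound : ∀ lo hi e zs → e ≡ hi ℤ.- lo → lo ℤ.≤ hi → Unique zs → Sidon zs →
                  All (lo ℤ.≤_) zs → All (ℤ._≤ hi) zs → DiamBound 206 (length zs) e
sidon-diamBound lo hi e zs refl lo≤hi zs! sidon lo≤ ≤hi =
  let m , lower , upper = scaledSqrt (length zs * length zs * length zs)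
  in subst (DiamBound 206 (length zs)) +d≡
       (diamBound (length zs) d m (10k²≤ lo d m zs zs! sidon inside lower upper) lower)
  where
  d : ℕ
  d = ∣ hi ℤ.- lo ∣

  +d≡ : + d ≡ hi ℤ.- lo
  +d≡ = ℤ.0≤i⇒+∣i∣≡i (ℤ.i≤j⇒0≤j-i lo≤hi)

  cancel : ∀ x y → y ≡ x ℤ.+ (y ℤ.- x)
  cancel = ℤ-RingSolver.solve-∀

  hi≡ : hi ≡ lo ℤ.+ + d
  hi≡ = trans (cancel lo hi) (cong (ℤ._+_ lo) (sym +d≡))

  inside : All (λ z → lo ℤ.≤ z × z ℤ.≤ lo ℤ.+ + d) zs
  inside = All.zip (lo≤ , All.map (λ {z} → subst (z ℤ.≤_) hi≡) ≤hi)

theorem3 : ∃ λ (C : ℕ) → (a : ℤ) (as : List ℤ) → Unique (a ∷ as) → Sidon (a ∷ as) →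
    DiamBound C (length (a ∷ as)) (diam a as)
theorem3 = 206 , λ a as as! sidon →
  sidon-diamBound (minL a as) (maxL a as) (diam a as) (a ∷ as) refl
    (ℤ.≤-trans (All.head (minL-≤ a as)) (All.head (≤-maxL a as)))
    as! sidon (minL-≤ a as) (≤-maxL a as)
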